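{- 1. If there exists an $(r,t)$-Ruzsa–Szemerédi graph on $n$ vertices, then $\overline{\alpha}_3(\tfrac n2,t)\ge \tfrac{rt}{2}$. 2. If $\overline{\alpha}_3(n,t)\ge rt$, then there exists an $(\tfrac r2,t)$-Ruzsa–Szemerédi graph on $n$ vertices.
   Context: A graph is called an $(r,t)$-Ruzsa–Szemerédi graph if its edge set can be partitioned into $t$ pairwise edge-disjoint induced matchings, each of size $r$ (a matching $M$ in a graph is induced if the subgraph induced on the vertices covered by $M$ has no edges other than those of $M$). For a subgraph $G$ of the complete tripartite graph $K_{m,m,N}$, $\overline{\alpha}_3(G)$ is the largest cardinality of a family of pairwise edge-disjoint triangles in $G$ such that the union of the triangles in the family contains no triangle other than those of the family. $\overline{\alpha}_3(m,N)=\max_G\overline{\alpha}_3(G)$, where the maximum is over all subgraphs $G$ of $K_{m,m,N}$.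
   Formalization: In part 2 the Ruzsa–Szemerédi graph has 2n vertices instead of n, since the printed count is false (n=8, r=4, t=8); the halves n/2 (part 1) and r/2 (part 2) are rounded up when odd. -}

module Defs where

open import Level using (0ℓ)
open import Data.Nat using (ℕ)
open import Data.Fin using (Fin)
import Data.Fin.Properties as Fin
open import Data.List using (List; []; _∷_; _++_; map; filter; length; concatMap; allFin; cartesianProduct)
open import Data.List.Extrema.Nat using (max)
open import Data.List.Membership.Propositional using (_∈_; _∉_)
import Data.List.Membership.DecPropositional as DecMembership
open import Data.List.Relation.Binary.Disjoint.Propositional using (Disjoint)
open import Data.List.Relation.Unary.All as All using (All)
open import Data.List.Relation.Unary.AllPairs as AllPairs using (AllPairs)
open import Data.Product using (∃; _×_; _,_)
import Data.Product.Properties as Product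
open import Data.Sum using (_⊎_; inj₁; inj₂)
import Data.Sum.Properties as Sum
open import Relation.Binary using (Rel; Decidable; DecidableEquality; Symmetric)
open import Relation.Binary.PropositionalEquality using (_≡_)
open import Relation.Nullary using (¬_; Dec; ¬?; _×-dec_; _→-dec_)
open import Relation.Nullary.Decidable using (map′)

record Graph (n : ℕ) : Set₁ where
  field
    Adj    : Rel (Fin n) 0ℓ
    adj?   : Decidable Adj
    sym    : Symmetric Adj
    irrefl : ∀ {v} → ¬ Adj v v

-- A set of edges on Fin n is listed with one arbitrarily oriented pair per
-- edge; Joins forgets the orientation.
EdgeList : ℕ → Set
EdgeList n = List (Fin n × Fin n)

Joins : ∀ {n} → EdgeList n → Fin n → Fin n → Set
Joins M u v = (u , v) ∈ M ⊎ (v , u) ∈ M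

ends : ∀ {n} → Fin n × Fin n → List (Fin n)
ends (u , v) = u ∷ v ∷ []

covered : ∀ {n} → EdgeList n → List (Fin n)
covered = concatMap ends

-- By disjoint, distinct positions of M carry distinct edges, so length M is
-- the size of the matching.
record InducedMatching {n} (G : Graph n) (M : EdgeList n) : Set where
  open Graph G
  field
    edges    : ∀ {u v} → (u , v) ∈ M → Adj u v
    disjoint : AllPairs (λ e f → Disjoint (ends e) (ends f)) M
    induced  : ∀ {u v} → u ∈ covered M → v ∈ covered M → Adj u v → Joins M u v

record RuzsaSzemerédi {n} (r t : ℕ) (G : Graph n) : Set where
  open Graph G
  field
    matching     : Fin t → EdgeList n
    isInduced    : ∀ i → InducedMatching G (matching i)
    size         : ∀ i → length (matching i) ≡ r
    edgeDisjoint : ∀ {i j u v} → Joins (matching i) u v → Joins (matching j) u v → i ≡ j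
    covers       : ∀ {u v} → Adj u v → ∃ λ i → Joins (matching i) u v

sublists : ∀ {a} {A : Set a} → List A → List (List A)
sublists []       = [] ∷ []
sublists (x ∷ xs) = map (x ∷_) (sublists xs) ++ sublists xs

-- The complete tripartite graph K_{m,m,N} with parts A = Fin m, B = Fin m and
-- C = Fin N.
module Tripartite (m N : ℕ) where

  -- The three summands are the A–B, A–C and B–C edges.
  Edge : Set
  Edge = (Fin m × Fin m) ⊎ (Fin m × Fin N) ⊎ (Fin m × Fin N)

  pattern ab a b = inj₁ (a , b)
  pattern ac a c = inj₂ (inj₁ (a , c))
  pattern bc b c = inj₂ (inj₂ (b , c))

  -- Vertices in the same part are never adjacent, so a triangle has exactly
  -- one vertex in each part.
  Triangle : Set
  Triangle = Fin m × Fin m × Fin N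

  sides : Triangle → List Edge
  sides (a , b , c) = ab a b ∷ ac a c ∷ bc b c ∷ []

  allEdges : List Edge
  allEdges = map (λ (a , b) → ab a b) (cartesianProduct (allFin m) (allFin m))
          ++ map (λ (a , c) → ac a c) (cartesianProduct (allFin m) (allFin N))
          ++ map (λ (b , c) → bc b c) (cartesianProduct (allFin m) (allFin N))

  allTriangles : List Triangle
  allTriangles = cartesianProduct (allFin m) (cartesianProduct (allFin m) (allFin N))

  -- A subgraph is given by its edges; isolated vertices lie in no triangle.
  Subgraph : Set
  Subgraph = List Edge

  _IsTriangleOf_ : Triangle → Subgraph → Set
  T IsTriangleOf G = All (_∈ G) (sides T)

  EdgeDisjoint : Triangle → Triangle → Set
  EdgeDisjoint S T = All (_∉ sides T) (sides S)

  union : List Triangle → Subgraph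
  union = concatMap sides

  record Admissible (G : Subgraph) (F : List Triangle) : Set where
    constructor admissible
    field
      triangles    : All (_IsTriangleOf G) F
      edgeDisjoint : AllPairs EdgeDisjoint F
      noOther      : ∀ a b c → (a , b , c) IsTriangleOf union F → (a , b , c) ∈ F

  _≟ₑ_ : DecidableEquality Edge
  _≟ₑ_ = Sum.≡-dec (Product.≡-dec Fin._≟_ Fin._≟_)
          (Sum.≡-dec (Product.≡-dec Fin._≟_ Fin._≟_) (Product.≡-dec Fin._≟_ Fin._≟_))

  _≟ₜ_ : DecidableEquality Triangle
  _≟ₜ_ = Product.≡-dec Fin._≟_ (Product.≡-dec Fin._≟_ Fin._≟_)

  open DecMembership _≟ₑ_ using () renaming (_∈?_ to _∈ₑ?_)
  open DecMembership _≟ₜ_ using () renaming (_∈?_ to _∈ₜ?_)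

  isTriangleOf? : ∀ T G → Dec (T IsTriangleOf G)
  isTriangleOf? T G = All.all? (_∈ₑ? G) (sides T)

  admissible? : ∀ G F → Dec (Admissible G F)
  admissible? G F = map′
    (λ (p , q , s) → admissible p q s)
    (λ (admissible p q s) → p , q , s)
    (All.all? (λ T → isTriangleOf? T G) F
      ×-dec AllPairs.allPairs? (λ S T → All.all? (λ e → ¬? (e ∈ₑ? sides T)) (sides S)) F
      ×-dec Fin.all? λ a → Fin.all? λ b → Fin.all? λ c →
        isTriangleOf? (a , b , c) (union F) →-dec ((a , b , c) ∈ₜ? F))

  -- The default value 0 of max is harmless: the empty family is admissible.
  α₃ᴳ : Subgraph → ℕ
  α₃ᴳ G = max 0 (map length (filter (admissible? G) (sublists allTriangles)))

α₃ : ℕ → ℕ → ℕ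
α₃ m N = max 0 (map α₃ᴳ (sublists allEdges))
  where open Tripartite m N

{-# OPTIONS --safe #-}

-- Part 1: pair up the vertices and place the two vertices of each pair on
-- opposite sides, choosing the orientation of every pair independently at
-- random. Each edge crosses with probability at least 1/2 (exactly 1/2 between
-- different pairs, 1 inside a pair), so some balanced cut is crossed by at least
-- half of the rt edges. Joining each crossing edge of the i-th matching to the
-- i-th vertex of C gives edge-disjoint triangles, and inducedness of the
-- matchings says that their union contains no further triangle.
--
-- Part 2: in an optimal family the A–B edges of the triangles through a fixed
-- c ∈ C form an induced matching in the union of all these matchings. Their
-- sizes need not be equal, but cutting each into pieces of size s = ⌈ r /2⌉
-- loses at most s - 1 edges per matching, hence leaves at least t pieces.
module Submission where

open import Defs
open import Level using (0ℓ)
open import Data.Bool using (Bool; true; false; T; _xor_; if_then_else_)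
open import Data.Bool.Properties using (T?)
open import Data.Empty using (⊥-elim)
open import Data.Fin using (Fin; zero; suc; combine; inject≤)
import Data.Fin.Properties as Fin
open import Data.List using (List; []; _∷_; _++_; map; filter; filterᵇ; length; concat; allFin; cartesianProduct; lookup)
open import Data.List.Extrema.Nat using (max; argmax-sel; v≤max⁺)
open import Data.List.Membership.Propositional using (_∈_; find; lose)
open import Data.List.Membership.Propositional.Properties
import Data.List.Membership.DecPropositional as DecMembership
open import Data.List.Properties using (concat-++; length-++; length-map; length-tabulate)
open import Data.List.Relation.Binary.Disjoint.Propositional using (Disjoint)
open import Data.List.Relation.Binary.Sublist.Propositional as Sublist using ([]; _∷_; _∷ʳ_; ⊆-refl) renaming (_⊆_ to _⊑_)
open import Data.List.Relation.Binary.Sublist.Propositional.Properties using (All-resp-⊆; filter-⊆; ++⁺; ++⁺ˡ; ++⁺ʳ)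
open import Data.List.Relation.Binary.Subset.Propositional using (_⊆_)
open import Data.List.Relation.Unary.All as All using (All; []; _∷_)
import Data.List.Relation.Unary.All.Properties as All
open import Data.List.Relation.Unary.AllPairs as AllPairs using (AllPairs; []; _∷_)
import Data.List.Relation.Unary.AllPairs.Properties as AllPairs
open import Data.List.Relation.Unary.Any as Any using (Any; here; there; index)
import Data.List.Relation.Unary.Any.Properties as Any
open import Data.List.Relation.Unary.Unique.Propositional using (Unique)
import Data.List.Relation.Unary.Unique.Propositional.Properties as Unique
open import Data.Nat using (ℕ; zero; suc; _+_; _*_; _^_; _≤_; z≤n; s≤s; ⌊_/2⌋; ⌈_/2⌉)
open import Data.Nat.Properties
open import Data.Nat.Tactic.RingSolver using (solve-∀)
open import Data.Product using (∃; ∃₂; _×_; _,_; proj₁; proj₂; map₁; map₂)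
open import Data.Product.Properties as Product using (,-injectiveˡ; ,-injectiveʳ)
open import Data.Sum as Sum using (_⊎_; inj₁; inj₂; swap; [_,_]′)
import Data.Vec.Functional as Vector
open import Function using (_∘_; id)
open import Relation.Binary using (Rel)
open import Relation.Binary.PropositionalEquality
open import Relation.Nullary using (¬_; yes; no; contradiction; _⊎-dec_)

-- Lists: distinct entries, sublists, and cutting into pieces of equal length.

module _ {A : Set} where

  AllPairs-map∈ : {R S : Rel A 0ℓ} {xs : List A} →
    (∀ {x y} → x ∈ xs → y ∈ xs → R x y → S x y) → AllPairs R xs → AllPairs S xs
  AllPairs-map∈ f []       = []
  AllPairs-map∈ f (p ∷ ps) =
    All.tabulate (λ y∈ → f (here refl) (there y∈) (All.lookup p y∈))
    ∷ AllPairs-map∈ (λ x∈ y∈ → f (there x∈) (there y∈)) ps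

  AllPairs-resp-⊑ : {R : Rel A 0ℓ} {xs ys : List A} → xs ⊑ ys → AllPairs R ys → AllPairs R xs
  AllPairs-resp-⊑ []         []       = []
  AllPairs-resp-⊑ (_ ∷ʳ τ)   (_ ∷ ps) = AllPairs-resp-⊑ τ ps
  AllPairs-resp-⊑ (refl ∷ τ) (p ∷ ps) = All-resp-⊆ τ p ∷ AllPairs-resp-⊑ τ ps

  Unique⇒lookup-injective : {xs : List A} → Unique xs → ∀ {i j} → lookup xs i ≡ lookup xs j → i ≡ j
  Unique⇒lookup-injective (_ ∷ _)  {zero}  {zero}  _  = refl
  Unique⇒lookup-injective (p ∷ _)  {zero}  {suc j} eq = contradiction eq (All.lookup p (∈-lookup j))
  Unique⇒lookup-injective (p ∷ _)  {suc i} {zero}  eq = contradiction (sym eq) (All.lookup p (∈-lookup i))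
  Unique⇒lookup-injective (_ ∷ ps) {suc i} {suc j} eq = cong suc (Unique⇒lookup-injective ps eq)

  -- Pigeonhole: sending a position of `xs` to the place of its entry in `ys` is injective, because
  -- the entry can be recovered from that place.
  Unique-⊆⇒length≤ : {xs ys : List A} → Unique xs → xs ⊆ ys → length xs ≤ length ys
  Unique-⊆⇒length≤ {xs} {ys} xs! xs⊆ys = Fin.injective⇒≤ {f = position} λ {i} {j} eq →
    Unique⇒lookup-injective xs!
      (trans (Any.lookup-index (xs⊆ys (∈-lookup i)))
        (trans (cong (lookup ys) eq) (sym (Any.lookup-index (xs⊆ys (∈-lookup j))))))
    where
    position : Fin (length xs) → Fin (length ys)
    position i = index (xs⊆ys (∈-lookup i))

  ⊑⇒∈-sublists : {xs ys : List A} → xs ⊑ ys → xs ∈ sublists ys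
  ⊑⇒∈-sublists []         = here refl
  ⊑⇒∈-sublists (y ∷ʳ τ)   = ∈-++⁺ʳ (map (y ∷_) _) (⊑⇒∈-sublists τ)
  ⊑⇒∈-sublists (refl ∷ τ) = ∈-++⁺ˡ (∈-map⁺ (_ ∷_) (⊑⇒∈-sublists τ))

  ∈⇒⊑concat : ∀ {xs : List A} {xss} → xs ∈ xss → xs ⊑ concat xss
  ∈⇒⊑concat {xss = _ ∷ xss} (here refl) = ++⁺ʳ (concat xss) ⊆-refl
  ∈⇒⊑concat {xss = xs ∷ _}  (there xs∈) = ++⁺ˡ xs (∈⇒⊑concat xs∈)

  length-concat-const : ∀ {r} {xss : List (List A)} → All (λ xs → length xs ≡ r) xss →
    length (concat xss) ≡ length xss * r
  length-concat-const []                    = refl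
  length-concat-const {xss = xs ∷ _} (refl ∷ ps) =
    trans (length-++ xs) (cong (length xs +_) (length-concat-const ps))

  Unique-++⇒disjoint : ∀ (xs : List A) {ys} → Unique (xs ++ ys) → Disjoint xs ys
  Unique-++⇒disjoint (x ∷ xs) (p ∷ _) (here refl , y∈) = All.lookup p (∈-++⁺ʳ xs y∈) refl
  Unique-++⇒disjoint (x ∷ xs) (_ ∷ u) (there x∈ , y∈)  = Unique-++⇒disjoint xs u (x∈ , y∈)

  -- Identifies positions of blocks and not only the blocks themselves; this is what later makes the
  -- matchings cut from a list edge-disjoint as an indexed family.
  Unique-concat⇒blocks-disjoint : ∀ (xss : List (List A)) → Unique (concat xss) →
    ∀ {x} i j → x ∈ lookup xss i → x ∈ lookup xss j → i ≡ j
  Unique-concat⇒blocks-disjoint (xs ∷ xss) u zero zero _ _ = refl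
  Unique-concat⇒blocks-disjoint (xs ∷ xss) u zero (suc j) x∈ y∈ =
    ⊥-elim (Unique-++⇒disjoint xs u (x∈ , ∈-concat⁺′ y∈ (∈-lookup {xs = xss} j)))
  Unique-concat⇒blocks-disjoint (xs ∷ xss) u (suc i) zero x∈ y∈ =
    ⊥-elim (Unique-++⇒disjoint xs u (y∈ , ∈-concat⁺′ x∈ (∈-lookup {xs = xss} i)))
  Unique-concat⇒blocks-disjoint (xs ∷ xss) u (suc i) (suc j) x∈ y∈ =
    cong suc (Unique-concat⇒blocks-disjoint xss (AllPairs-resp-⊑ (++⁺ˡ xs ⊆-refl) u) i j x∈ y∈)

  -- Pieces are built from the right end. `rest` is the unfinished piece at the front; it becomes a
  -- chunk, and a new `rest` starts empty, as soon as it has `suc s` entries. Hence at most `s`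
  -- entries are left over.
  chop : ∀ s (xs : List A) → ∃₂ λ chunks rest →
    rest ++ concat chunks ≡ xs × All (λ C → length C ≡ suc s) chunks × length rest ≤ s
  chop s []       = [] , [] , refl , [] , z≤n
  chop s (x ∷ xs) with chop s xs
  ... | chunks , rest , refl , sizes , rest≤s with length rest ≟ s
  ...   | yes eq = (x ∷ rest) ∷ chunks , [] , refl , cong suc eq ∷ sizes , z≤n
  ...   | no neq = chunks , x ∷ rest , refl , sizes , ≤∧≢⇒< rest≤s neq

  -- The lists are chopped separately, so that every chunk stays within a single one of them; the
  -- price is a remainder of up to `s` entries for each list.
  chopAll : ∀ s (xss : List (List A)) → ∃ λ chunks →
    All (λ C → length C ≡ suc s × Any (C ⊑_) xss) chunks ×
    concat chunks ⊑ concat xss ×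
    length (concat xss) ≤ length chunks * suc s + length xss * s
  chopAll s []         = [] , [] , [] , z≤n
  chopAll s (xs ∷ xss) with chop s xs | chopAll s xss
  ... | Cs , rest , refl , sizes , rest≤s | Ds , Ds-ok , Ds⊑ , bound =
    Cs ++ Ds
    , All.++⁺ (All.tabulate λ C∈ → All.lookup sizes C∈ , here (++⁺ˡ rest (∈⇒⊑concat C∈)))
              (All.map (λ (len , C⊑) → len , there C⊑) Ds-ok)
    , subst (_⊑ _) (concat-++ Cs Ds) (++⁺ (++⁺ˡ rest ⊆-refl) Ds⊑)
    , count
    where
    open ≤-Reasoning
    count : length ((rest ++ concat Cs) ++ concat xss) ≤ length (Cs ++ Ds) * suc s + (s + length xss * s)
    count = begin
      length ((rest ++ concat Cs) ++ concat xss)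
        ≡⟨ length-++ (rest ++ concat Cs) ⟩
      length (rest ++ concat Cs) + length (concat xss)
        ≡⟨ cong (_+ length (concat xss)) (trans (length-++ rest) (cong (length rest +_) (length-concat-const sizes))) ⟩
      length rest + length Cs * suc s + length (concat xss)
        ≤⟨ +-mono-≤ (+-monoˡ-≤ _ rest≤s) bound ⟩
      s + length Cs * suc s + (length Ds * suc s + length xss * s)
        ≡⟨ rearrange s (length Cs) (length Ds) (length xss) ⟩
      (length Cs + length Ds) * suc s + (s + length xss * s)
        ≡⟨ cong (λ l → l * suc s + (s + length xss * s)) (length-++ Cs) ⟨
      length (Cs ++ Ds) * suc s + (s + length xss * s) ∎
      where
      rearrange : ∀ s c d l → s + c * suc s + (d * suc s + l * s) ≡ (c + d) * suc s + (s + l * s)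
      rearrange = solve-∀

  -- The first alternative is the default value 0 of `max`, which no entry of `xs` need attain.
  max-attained : ∀ (f : A → ℕ) xs → max 0 (map f xs) ≡ 0 ⊎ (∃ λ x → x ∈ xs × max 0 (map f xs) ≡ f x)
  max-attained f xs = Sum.map₂ (∈-map⁻ f) (argmax-sel id 0 (map f xs))

-- Admissible triangle families and the value `α₃`.

module Families (m N : ℕ) where
  open Tripartite m N

  -- Admissibility rewritten without a host graph, in terms of membership in `F` alone. The
  -- uniqueness fields say that triangles with a common side coincide. In `closed` the three given
  -- triangles supply the sides ab, ac and bc of a triangle of the union, so the field expresses
  -- `noOther`.
  record Independent (F : List Triangle) : Set where
    field
      unique   : Unique F
      a-unique : ∀ {a a′ b c} → (a , b , c) ∈ F → (a′ , b , c) ∈ F → a ≡ a′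
      b-unique : ∀ {a b b′ c} → (a , b , c) ∈ F → (a , b′ , c) ∈ F → b ≡ b′
      c-unique : ∀ {a b c c′} → (a , b , c) ∈ F → (a , b , c′) ∈ F → c ≡ c′
      closed   : ∀ {a b c a′ b′ c′} →
        (a , b , c′) ∈ F → (a , b′ , c) ∈ F → (a′ , b , c) ∈ F → (a , b , c) ∈ F

  ab∈union : ∀ {F a b} → ab a b ∈ union F → ∃ λ c → (a , b , c) ∈ F
  ab∈union e∈ with find (∈-concatMap⁻ sides e∈)
  ... | _ , T∈ , here refl              = _ , T∈
  ... | _ , T∈ , there (here ())
  ... | _ , T∈ , there (there (here ()))

  ac∈union : ∀ {F a c} → ac a c ∈ union F → ∃ λ b → (a , b , c) ∈ F
  ac∈union e∈ with find (∈-concatMap⁻ sides e∈)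
  ... | _ , T∈ , there (here refl)      = _ , T∈
  ... | _ , T∈ , here ()
  ... | _ , T∈ , there (there (here ()))

  bc∈union : ∀ {F b c} → bc b c ∈ union F → ∃ λ a → (a , b , c) ∈ F
  bc∈union e∈ with find (∈-concatMap⁻ sides e∈)
  ... | _ , T∈ , there (there (here refl)) = _ , T∈
  ... | _ , T∈ , here ()
  ... | _ , T∈ , there (here ())

  side∈union : ∀ {F T e} → T ∈ F → e ∈ sides T → e ∈ union F
  side∈union T∈ e∈ = ∈-concatMap⁺ sides (lose T∈ e∈)

  Admissible⇒Independent : ∀ {G F} → Admissible G F → Independent F
  Admissible⇒Independent {F = F} adm = record
    -- A triangle has sides, so it is never edge-disjoint from itself.
    { unique   = AllPairs.map (λ { d refl → All.head d (here refl) }) edgeDisjoint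
    ; a-unique = λ S∈ T∈ → cong proj₁ (share S∈ T∈ (there (there (here refl))) (there (there (here refl))))
    ; b-unique = λ S∈ T∈ → cong (proj₁ ∘ proj₂) (share S∈ T∈ (there (here refl)) (there (here refl)))
    ; c-unique = λ S∈ T∈ → cong (proj₂ ∘ proj₂) (share S∈ T∈ (here refl) (here refl))
    ; closed   = λ p q r → noOther _ _ _
        ( side∈union p (here refl) ∷ side∈union q (there (here refl))
        ∷ side∈union r (there (there (here refl))) ∷ [])
    }
    where
    open Admissible adm
    share : ∀ {S T e} → S ∈ F → T ∈ F → e ∈ sides S → e ∈ sides T → S ≡ T
    share S∈ T∈ e∈S e∈T with ∈-AllPairs₂ edgeDisjoint S∈ T∈
    ... | inj₁ eq       = eq
    ... | inj₂ (inj₁ d) = contradiction e∈T (All.lookup d e∈S)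
    ... | inj₂ (inj₂ d) = contradiction e∈S (All.lookup d e∈T)

  ∈-allEdges : ∀ e → e ∈ allEdges
  ∈-allEdges (ab a b) = ∈-++⁺ˡ (∈-map⁺ _ (∈-cartesianProduct⁺ (∈-allFin a) (∈-allFin b)))
  ∈-allEdges (ac a c) = ∈-++⁺ʳ (map _ (cartesianProduct (allFin m) (allFin m)))
    (∈-++⁺ˡ (∈-map⁺ _ (∈-cartesianProduct⁺ (∈-allFin a) (∈-allFin c))))
  ∈-allEdges (bc b c) = ∈-++⁺ʳ (map _ (cartesianProduct (allFin m) (allFin m)))
    (∈-++⁺ʳ (map _ (cartesianProduct (allFin m) (allFin N)))
      (∈-map⁺ _ (∈-cartesianProduct⁺ (∈-allFin b) (∈-allFin c))))

  ∈-allTriangles : ∀ T → T ∈ allTriangles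
  ∈-allTriangles (a , b , c) =
    ∈-cartesianProduct⁺ (∈-allFin a) (∈-cartesianProduct⁺ (∈-allFin b) (∈-allFin c))

  allTriangles-unique : Unique allTriangles
  allTriangles-unique = Unique.cartesianProduct⁺ (Unique.allFin⁺ m)
    (Unique.cartesianProduct⁺ (Unique.allFin⁺ m) (Unique.allFin⁺ N))

  -- The host graph only has to contain the triangles, so the complete tripartite graph serves for
  -- every family.
  Independent⇒Admissible : ∀ {F} → Independent F → Admissible allEdges F
  Independent⇒Admissible {F} ind = admissible
    (All.tabulate λ _ → All.tabulate λ _ → ∈-allEdges _)
    (AllPairs-map∈ edge-disjoint unique)
    λ { a b c (p ∷ q ∷ r ∷ []) →
        closed (proj₂ (ab∈union p)) (proj₂ (ac∈union q)) (proj₂ (bc∈union r)) }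
    where
    open Independent ind
    edge-disjoint : ∀ {S T} → S ∈ F → T ∈ F → S ≢ T → EdgeDisjoint S T
    edge-disjoint {S} {T} S∈ T∈ S≢T =
      (λ { (here refl) → S≢T (cong (λ c → _ , _ , c) (c-unique S∈ T∈))
         ; (there (here ())) ; (there (there (here ()))) })
      ∷ (λ { (there (here refl)) → S≢T (cong (λ b → _ , b , _) (b-unique S∈ T∈))
           ; (here ()) ; (there (there (here ()))) })
      ∷ (λ { (there (there (here refl))) → S≢T (cong (λ a → a , _ , _) (a-unique S∈ T∈))
           ; (here ()) ; (there (here ())) })
      ∷ []

  Independent-cong : ∀ {F F′} → Unique F′ → F ⊆ F′ → F′ ⊆ F → Independent F → Independent F′
  Independent-cong F′! to from ind = record
    { unique   = F′!
    ; a-unique = λ p q → a-unique (from p) (from q)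
    ; b-unique = λ p q → b-unique (from p) (from q)
    ; c-unique = λ p q → c-unique (from p) (from q)
    ; closed   = λ p q r → to (closed (from p) (from q) (from r))
    }
    where open Independent ind

  open DecMembership _≟ₜ_ using (_∈?_)

  Independent⇒length≤α₃ : ∀ {F} → Independent F → length F ≤ α₃ m N
  Independent⇒length≤α₃ {F} ind = begin
    length F      ≤⟨ Unique-⊆⇒length≤ (Independent.unique ind) F⊆F′ ⟩
    length F′     ≤⟨ v≤max⁺ 0 _ (inj₂ (lose (∈-map⁺ length F′∈) ≤-refl)) ⟩
    α₃ᴳ allEdges  ≤⟨ v≤max⁺ 0 _ (inj₂ (lose (∈-map⁺ α₃ᴳ (⊑⇒∈-sublists ⊆-refl)) ≤-refl)) ⟩
    α₃ m N        ∎
    where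
    open ≤-Reasoning
    -- The maximum ranges over sublists of `allTriangles` only, so the family is first rearranged
    -- into the order of that list.
    F′ : List Triangle
    F′ = filter (_∈? F) allTriangles

    F⊆F′ : F ⊆ F′
    F⊆F′ T∈ = ∈-filter⁺ (_∈? F) (∈-allTriangles _) T∈

    F′-independent : Independent F′
    F′-independent = Independent-cong (Unique.filter⁺ (_∈? F) allTriangles-unique)
      F⊆F′ (λ T∈ → proj₂ (∈-filter⁻ (_∈? F) {xs = allTriangles} T∈)) ind

    F′∈ : F′ ∈ filter (admissible? allEdges) (sublists allTriangles)
    F′∈ = ∈-filter⁺ (admissible? allEdges) (⊑⇒∈-sublists (filter-⊆ (_∈? F) allTriangles))
      (Independent⇒Admissible F′-independent)

  []-independent : Independent []
  []-independent = record
    { unique = [] ; a-unique = λ () ; b-unique = λ () ; c-unique = λ () ; closed = λ () }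

  -- When the maximum is the default 0, the empty family attains it.
  α₃ᴳ-attained : ∀ G → ∃ λ F → Independent F × length F ≡ α₃ᴳ G
  α₃ᴳ-attained G = [ none , some ]′ (max-attained length (filter (admissible? G) (sublists allTriangles)))
    where
    none : α₃ᴳ G ≡ 0 → ∃ λ F → Independent F × length F ≡ α₃ᴳ G
    none eq = [] , []-independent , sym eq

    some : (∃ λ F → F ∈ filter (admissible? G) (sublists allTriangles) × α₃ᴳ G ≡ length F) →
      ∃ λ F → Independent F × length F ≡ α₃ᴳ G
    some (F , F∈ , eq) =
      F , Admissible⇒Independent (proj₂ (∈-filter⁻ (admissible? G) {xs = sublists allTriangles} F∈)) , sym eq

  α₃-attained : ∃ λ F → Independent F × length F ≡ α₃ m N
  α₃-attained = [ none , some ]′ (max-attained α₃ᴳ (sublists allEdges))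
    where
    none : α₃ m N ≡ 0 → ∃ λ F → Independent F × length F ≡ α₃ m N
    none eq = [] , []-independent , sym eq

    some : (∃ λ G → G ∈ sublists allEdges × α₃ m N ≡ α₃ᴳ G) → ∃ λ F → Independent F × length F ≡ α₃ m N
    some (G , _ , eq) = map₂ (map₂ λ F≡αG → trans F≡αG (sym eq)) (α₃ᴳ-attained G)

-- From a triangle family to a Ruzsa-Szemerédi graph.

module ColourClassMatchings {n t : ℕ} where
  open Tripartite n t
  open Families n t

  colour : Triangle → Fin t
  colour (_ , _ , c) = c

  -- What the graph construction needs from the counting argument. Each block lies within one
  -- colour, but several blocks may share a colour; `disjoint` only keeps a triangle from occurring
  -- in two blocks.
  record ColouredBlocks (s : ℕ) (F : List Triangle) : Set where
    field
      block         : Fin t → List Triangle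
      size          : ∀ i → length (block i) ≡ s
      unique        : ∀ i → Unique (block i)
      block⊆        : ∀ i → block i ⊆ F
      monochromatic : ∀ i {S T} → S ∈ block i → T ∈ block i → colour S ≡ colour T
      disjoint      : ∀ {T} i j → T ∈ block i → T ∈ block j → i ≡ j

  -- The vertices of the graph are those of the parts A and B, hence `2 * n` of them.
  left right : Fin n → Fin (2 * n)
  left  = combine {2} zero
  right = combine {2} {n} (suc zero)

  left-injective : ∀ {a a′} → left a ≡ left a′ → a ≡ a′
  left-injective = Fin.combine-injectiveʳ {2} {n} zero _ zero _

  right-injective : ∀ {b b′} → right b ≡ right b′ → b ≡ b′
  right-injective = Fin.combine-injectiveʳ {2} {n} (suc zero) _ (suc zero) _

  left≢right : ∀ {a b} → left a ≢ right b
  left≢right eq with Fin.combine-injectiveˡ {2} {n} zero _ (suc zero) _ eq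
  ... | ()

  edge : Triangle → Fin (2 * n) × Fin (2 * n)
  edge (a , b , _) = left a , right b

  module _ {s F} (ind : Independent F) (blocks : ColouredBlocks s F) where
    open Independent ind using (a-unique; b-unique; c-unique; closed)
    open ColouredBlocks blocks

    matching : Fin t → EdgeList (2 * n)
    matching i = map edge (block i)

    -- Only the edges of the blocks are kept, so `covers` holds by definition. Inducedness must then
    -- be checked against the edges of all blocks, including those of the same colour.
    Adj : Rel (Fin (2 * n)) 0ℓ
    Adj u v = ∃ λ i → Joins (matching i) u v

    open DecMembership (Product.≡-dec (Fin._≟_ {2 * n}) (Fin._≟_ {2 * n})) using (_∈?_)

    graph : Graph (2 * n)
    graph = record
      { Adj    = Adj
      ; adj?   = λ u v → Fin.any? λ i → ((u , v) ∈? matching i) ⊎-dec ((v , u) ∈? matching i)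
      ; sym    = map₂ swap
      ; irrefl = λ { (i , inj₁ e∈) → loopless e∈ ; (i , inj₂ e∈) → loopless e∈ }
      }
      where
      loopless : ∀ {i v} → ¬ (v , v) ∈ matching i
      loopless e∈ with ∈-map⁻ edge e∈
      ... | _ , _ , eq = left≢right (trans (sym (,-injectiveˡ eq)) (,-injectiveʳ eq))

    left∈covered : ∀ i {a} → left a ∈ covered (matching i) → ∃₂ λ b c → (a , b , c) ∈ block i
    left∈covered i u∈ with find (∈-concatMap⁻ ends {xs = matching i} u∈)
    ... | _ , e∈ , x∈ with ∈-map⁻ edge e∈
    left∈covered i u∈ | _ , e∈ , here eq         | _ , T∈ , refl with left-injective eq
    ... | refl = _ , _ , T∈
    left∈covered i u∈ | _ , e∈ , there (here eq) | _ , T∈ , refl = contradiction eq left≢right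

    right∈covered : ∀ i {b} → right b ∈ covered (matching i) → ∃₂ λ a c → (a , b , c) ∈ block i
    right∈covered i v∈ with find (∈-concatMap⁻ ends {xs = matching i} v∈)
    ... | _ , e∈ , x∈ with ∈-map⁻ edge e∈
    right∈covered i v∈ | _ , e∈ , here eq         | _ , T∈ , refl = contradiction (sym eq) left≢right
    right∈covered i v∈ | _ , e∈ , there (here eq) | _ , T∈ , refl with right-injective eq
    ... | refl = _ , _ , T∈

    -- closed puts a triangle on ab into the colour class of block i; there it
    -- is the only one through a, hence it lies in block i itself.
    edge∈block : ∀ i {j a b c} → (a , b , c) ∈ block j →
      left a ∈ covered (matching i) → right b ∈ covered (matching i) → (left a , right b) ∈ matching i
    edge∈block i T∈ u∈ v∈ with left∈covered i u∈ | right∈covered i v∈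
    ... | b′ , c , S∈ | a′ , _ , R∈ with monochromatic i S∈ R∈
    ...   | refl with b-unique (closed (block⊆ _ T∈) (block⊆ i S∈) (block⊆ i R∈)) (block⊆ i S∈)
    ...     | refl = ∈-map⁺ edge S∈

    -- An A-B edge determines its triangle by `c-unique`, and a triangle determines its block.
    edge-shared : ∀ {i j e} → e ∈ matching i → e ∈ matching j → i ≡ j
    edge-shared e∈ e∈′ with ∈-map⁻ edge e∈ | ∈-map⁻ edge e∈′
    ... | _ , S∈ , refl | _ , T∈ , eq
      with left-injective (,-injectiveˡ eq) | right-injective (,-injectiveʳ eq)
    ...   | refl | refl with c-unique (block⊆ _ S∈) (block⊆ _ T∈)
    ...     | refl = disjoint _ _ S∈ T∈

    -- Every edge is listed from left to right, which rules out the mixed orientations in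
    -- `edgeDisjoint`.
    not-reversed : ∀ {i j u v} → (u , v) ∈ matching i → ¬ (v , u) ∈ matching j
    not-reversed e∈ e∈′ with ∈-map⁻ edge e∈ | ∈-map⁻ edge e∈′
    ... | _ , _ , refl | _ , _ , eq = left≢right (,-injectiveʳ eq)

    -- Triangles of one block have the same colour c, so a common endpoint of their A-B edges would
    -- give them a common side at c.
    ends-disjoint : ∀ i {S T} → S ∈ block i → T ∈ block i → S ≢ T → Disjoint (ends (edge S)) (ends (edge T))
    ends-disjoint i S∈ T∈ S≢T (x∈ , y∈) with monochromatic i S∈ T∈
    ends-disjoint i S∈ T∈ S≢T (here refl , here eq) | refl with left-injective eq
    ... | refl = S≢T (cong (λ b → _ , b , _) (b-unique (block⊆ i S∈) (block⊆ i T∈)))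
    ends-disjoint i S∈ T∈ S≢T (here refl , there (here eq)) | refl = left≢right eq
    ends-disjoint i S∈ T∈ S≢T (there (here refl) , here eq) | refl = left≢right (sym eq)
    ends-disjoint i S∈ T∈ S≢T (there (here refl) , there (here eq)) | refl with right-injective eq
    ... | refl = S≢T (cong (_, _) (a-unique (block⊆ i S∈) (block⊆ i T∈)))

    matching-induced : ∀ i → InducedMatching graph (matching i)
    matching-induced i = record
      { edges    = λ e∈ → i , inj₁ e∈
      ; disjoint = AllPairs.map⁺ (AllPairs-map∈ (ends-disjoint i) (unique i))
      ; induced  = λ { u∈ v∈ (j , inj₁ e∈) → inj₁ (induced e∈ u∈ v∈)
                     ; u∈ v∈ (j , inj₂ e∈) → inj₂ (induced e∈ v∈ u∈) }
      }
      where
      induced : ∀ {j u v} → (u , v) ∈ matching j →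
        u ∈ covered (matching i) → v ∈ covered (matching i) → (u , v) ∈ matching i
      induced e∈ u∈ v∈ with ∈-map⁻ edge e∈
      ... | _ , T∈ , refl = edge∈block i T∈ u∈ v∈

    ruzsaSzemerédi : RuzsaSzemerédi s t graph
    ruzsaSzemerédi = record
      { matching     = matching
      ; isInduced    = matching-induced
      ; size         = λ i → trans (length-map edge (block i)) (size i)
      ; edgeDisjoint = λ
          { (inj₁ p) (inj₁ q) → edge-shared p q
          ; (inj₁ p) (inj₂ q) → contradiction q (not-reversed p)
          ; (inj₂ p) (inj₁ q) → contradiction q (not-reversed p)
          ; (inj₂ p) (inj₂ q) → edge-shared p q }
      ; covers       = id
      }

  -- Cutting the colour classes into blocks of equal size.

  module _ {F} (ind : Independent F) where
    open Independent ind using (unique)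

    class : Fin t → List Triangle
    class c = filter (λ T → colour T Fin.≟ c) F

    classes : List (List Triangle)
    classes = map class (allFin t)

    colour-class : ∀ {c T} → T ∈ class c → colour T ≡ c
    colour-class {c} T∈ = proj₂ (∈-filter⁻ (λ T → colour T Fin.≟ c) {xs = F} T∈)

    class⊆ : ∀ {c} → class c ⊆ F
    class⊆ {c} T∈ = proj₁ (∈-filter⁻ (λ T → colour T Fin.≟ c) {xs = F} T∈)

    ⊆classes : F ⊆ concat classes
    ⊆classes T∈ = ∈-concat⁺′ (∈-filter⁺ (λ T → colour T Fin.≟ _) T∈ refl) (∈-map⁺ class (∈-allFin _))

    classes-unique : Unique (concat classes)
    classes-unique = Unique.concat⁺
      (All.map⁺ (All.tabulate λ {c} _ → Unique.filter⁺ (λ T → colour T Fin.≟ c) unique))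
      (AllPairs.map⁺ (AllPairs.map classes-disjoint (Unique.allFin⁺ t)))
      where
      classes-disjoint : ∀ {c c′} → c ≢ c′ → Disjoint (class c) (class c′)
      classes-disjoint {c} {c′} c≢c′ (T∈ , T∈′) =
        c≢c′ (trans (sym (colour-class {c} T∈)) (colour-class {c′} T∈′))

    colouredBlocks : ∀ s → suc (s + s) * t ≤ length F → ColouredBlocks (suc s) F
    colouredBlocks s big with chopAll s classes
    ... | chunks , ok , chunks⊑ , bound = record
      { block         = block
      ; size          = λ i → proj₁ (good i)
      ; unique        = λ i → AllPairs-resp-⊑ (∈⇒⊑concat (chunk∈ i)) chunks-unique
      ; block⊆        = λ i T∈ → let c , C⊑ = in-class i in class⊆ {c} (Sublist.lookup C⊑ T∈)
      ; monochromatic = λ i S∈ T∈ → let c , C⊑ = in-class i in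
          trans (colour-class {c} (Sublist.lookup C⊑ S∈)) (sym (colour-class {c} (Sublist.lookup C⊑ T∈)))
      ; disjoint      = λ i j S∈ T∈ → Fin.inject≤-injective enough enough i j
          (Unique-concat⇒blocks-disjoint chunks chunks-unique _ _ S∈ T∈)
      }
      where
      chunks-unique : Unique (concat chunks)
      chunks-unique = AllPairs-resp-⊑ chunks⊑ classes-unique

      enough : t ≤ length chunks
      -- The `t` classes lose at most `t * s` of the `(2s + 1)t` triangles in total. The remaining
      -- `t * suc s` or more fill at least `t` chunks of size `suc s`.
      enough = *-cancelʳ-≤ t (length chunks) (suc s) (+-cancelʳ-≤ (t * s) _ _ (begin
        t * suc s + t * s                        ≡⟨ rearrange t s ⟩
        suc (s + s) * t                          ≤⟨ big ⟩
        length F                                 ≤⟨ Unique-⊆⇒length≤ unique ⊆classes ⟩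
        length (concat classes)                  ≤⟨ bound ⟩
        length chunks * suc s + length classes * s
          ≡⟨ cong (λ l → length chunks * suc s + l * s)
               (trans (length-map class (allFin t)) (length-tabulate {n = t} id)) ⟩
        length chunks * suc s + t * s            ∎))
        where
        open ≤-Reasoning
        rearrange : ∀ t s → t * suc s + t * s ≡ suc (s + s) * t
        rearrange = solve-∀

      -- The first `t` chunks are taken; any further ones are dropped.
      block : Fin t → List Triangle
      block i = lookup chunks (inject≤ i enough)

      chunk∈ : ∀ i → block i ∈ chunks
      chunk∈ i = ∈-lookup (inject≤ i enough)

      good : ∀ i → length (block i) ≡ suc s × Any (block i ⊑_) classes
      good i = All.lookup ok (chunk∈ i)

      in-class : ∀ i → ∃ λ c → block i ⊑ class c
      in-class i with find (proj₂ (good i))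
      ... | _ , xs∈ , C⊑ with ∈-map⁻ class xs∈
      ...   | c , _ , refl = c , C⊑

  emptyBlocks : ColouredBlocks 0 []
  emptyBlocks = record
    { block = λ _ → [] ; size = λ _ → refl ; unique = λ _ → [] ; block⊆ = λ _ ()
    ; monochromatic = λ _ () ; disjoint = λ _ _ () }

α₃⇒ruzsaSzemerédi : ∀ n r t → r * t ≤ α₃ n t → ∃ λ (G : Graph (2 * n)) → RuzsaSzemerédi ⌈ r /2⌉ t G
-- `colouredBlocks` yields blocks of positive size only, so `r = 0` is settled by empty matchings.
α₃⇒ruzsaSzemerédi n zero t _ = _ , ruzsaSzemerédi []-independent emptyBlocks
  where
  open Families n t
  open ColourClassMatchings {n} {t}
α₃⇒ruzsaSzemerédi n (suc r) t rt≤α = from α₃-attained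
  where
  open Families n t
  open ColourClassMatchings {n} {t}
  open ≤-Reasoning

  from : (∃ λ F → Independent F × length F ≡ α₃ n t) →
    ∃ λ (G : Graph (2 * n)) → RuzsaSzemerédi ⌈ suc r /2⌉ t G
  -- For `s = ⌊ r /2⌋` the block size `suc s` computes to `⌈ suc r /2⌉`, and `2s + 1` is at most
  -- `suc r`.
  from (F , ind , |F|≡α) = _ , ruzsaSzemerédi ind (colouredBlocks ind ⌊ r /2⌋ (begin
    suc (⌊ r /2⌋ + ⌊ r /2⌋) * t ≤⟨ *-monoˡ-≤ t (s≤s (+-monoʳ-≤ ⌊ r /2⌋ (⌊n/2⌋≤⌈n/2⌉ r))) ⟩
    suc (⌊ r /2⌋ + ⌈ r /2⌉) * t ≡⟨ cong (λ x → suc x * t) (⌊n/2⌋+⌈n/2⌉≡n r) ⟩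
    suc r * t                   ≤⟨ rt≤α ⟩
    α₃ n t                      ≡⟨ |F|≡α ⟨
    length F                    ∎))

-- Averaging over all Boolean choices.

-- This is `2 ^ k` times the expectation of `g` under `k` independent fair coin flips, which keeps
-- the probabilistic argument within the natural numbers.
total : ∀ k → ((Fin k → Bool) → ℕ) → ℕ
total zero    g = g Vector.[]
total (suc k) g = total k (λ f → g (true Vector.∷ f)) + total k (λ f → g (false Vector.∷ f))

total-+ : ∀ k (g h : (Fin k → Bool) → ℕ) → total k (λ f → g f + h f) ≡ total k g + total k h
total-+ zero    g h = refl
total-+ (suc k) g h = trans
  (cong₂ _+_ (total-+ k (λ f → g (true Vector.∷ f)) (λ f → h (true Vector.∷ f)))
             (total-+ k (λ f → g (false Vector.∷ f)) (λ f → h (false Vector.∷ f))))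
  (interchange (total k _) (total k _) (total k _) (total k _))
  where
  interchange : ∀ a b c d → (a + b) + (c + d) ≡ (a + c) + (b + d)
  interchange = solve-∀

total-mono : ∀ k {g h : (Fin k → Bool) → ℕ} → (∀ f → g f ≤ h f) → total k g ≤ total k h
total-mono zero    g≤h = g≤h Vector.[]
total-mono (suc k) g≤h = +-mono-≤ (total-mono k (λ f → g≤h _)) (total-mono k (λ f → g≤h _))

total-1 : ∀ k → total k (λ _ → 1) ≡ 2 ^ k
total-1 zero    = refl
total-1 (suc k) = trans (cong (λ x → x + x) (total-1 k)) (cong (2 ^ k +_) (sym (+-identityʳ (2 ^ k))))

-- Conditional expectations: the coordinates are fixed one after another, each to a value for which
-- the average over the remaining ones is still large enough. If both values failed, so would the
-- average over the two.
above-average : ∀ k {c} (g : (Fin k → Bool) → ℕ) → 2 ^ k * c ≤ 2 * total k g → ∃ λ f → c ≤ 2 * g f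
above-average zero    {c} g c≤ = Vector.[] , subst (_≤ 2 * g Vector.[]) (+-identityʳ c) c≤
above-average (suc k) {c} g c≤
  with 2 ^ k * c ≤? 2 * total k (λ f → g (true Vector.∷ f))
     | 2 ^ k * c ≤? 2 * total k (λ f → g (false Vector.∷ f))
... | yes c≤ₜ | _       = let f , c≤g = above-average k _ c≤ₜ in true Vector.∷ f , c≤g
... | no _    | yes c≤ᶠ = let f , c≤g = above-average k _ c≤ᶠ in false Vector.∷ f , c≤g
... | no c≰ₜ  | no c≰ᶠ  = contradiction c≤ (<⇒≱ (begin-strict
  2 * total (suc k) g
    ≡⟨ *-distribˡ-+ 2 (total k (λ f → g (true Vector.∷ f))) _ ⟩
  2 * total k (λ f → g (true Vector.∷ f)) + 2 * total k (λ f → g (false Vector.∷ f))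
    <⟨ +-mono-< (≰⇒> c≰ₜ) (≰⇒> c≰ᶠ) ⟩
  2 ^ k * c + 2 ^ k * c
    ≡⟨ double (2 ^ k) c ⟩
  2 ^ suc k * c ∎))
  where
  open ≤-Reasoning
  double : ∀ p c → p * c + p * c ≡ 2 * p * c
  double = solve-∀

⟦_⟧ : Bool → ℕ
⟦ b ⟧ = if b then 1 else 0

module _ {A : Set} where

  length-filterᵇ-∷ : ∀ (p : A → Bool) x xs → ⟦ p x ⟧ + length (filterᵇ p xs) ≡ length (filterᵇ p (x ∷ xs))
  length-filterᵇ-∷ p x xs with p x
  ... | true  = refl
  ... | false = refl

  -- Linearity of expectation: if each entry survives with probability at least 1/2, at least half
  -- of the entries survive on average.
  total-filterᵇ : ∀ k (p : (Fin k → Bool) → A → Bool) {xs} →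
    All (λ x → 2 ^ k ≤ 2 * total k (λ f → ⟦ p f x ⟧)) xs →
    2 ^ k * length xs ≤ 2 * total k (λ f → length (filterᵇ (p f) xs))
  total-filterᵇ k p []                     = subst (_≤ 2 * total k (λ _ → 0)) (sym (*-zeroʳ (2 ^ k))) z≤n
  total-filterᵇ k p {xs = x ∷ xs} (q ∷ qs) = begin
    2 ^ k * suc (length xs)
      ≡⟨ *-suc (2 ^ k) (length xs) ⟩
    2 ^ k + 2 ^ k * length xs
      ≤⟨ +-mono-≤ q (total-filterᵇ k p qs) ⟩
    2 * total k (λ f → ⟦ p f x ⟧) + 2 * total k (λ f → length (filterᵇ (p f) xs))
      ≡⟨ *-distribˡ-+ 2 (total k (λ f → ⟦ p f x ⟧)) _ ⟨
    2 * (total k (λ f → ⟦ p f x ⟧) + total k (λ f → length (filterᵇ (p f) xs)))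
      ≡⟨ cong (2 *_) (total-+ k _ _) ⟨
    2 * total k (λ f → ⟦ p f x ⟧ + length (filterᵇ (p f) xs))
      ≤⟨ *-monoʳ-≤ 2 (total-mono k (λ f → ≤-reflexive (length-filterᵇ-∷ (p f) x xs))) ⟩
    2 * total k (λ f → length (filterᵇ (p f) (x ∷ xs))) ∎
    where open ≤-Reasoning

-- Random orientations of paired vertices.

flip : ∀ {k} → (Fin k → Bool) → Fin k × Bool → Bool
flip f (i , x) = x xor f i

separation : ∀ {k} → Fin k × Bool → Fin k × Bool → (Fin k → Bool) → ℕ
separation p q f = ⟦ flip f p xor flip f q ⟧

-- Choices that differ only in coordinate 0 are grouped in twos; each of the `2 ^ k` groups
-- contributes at least 1.
coordinate-0-decides : ∀ k (g : (Fin (suc k) → Bool) → ℕ) →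
  (∀ f → 1 ≤ g (true Vector.∷ f) + g (false Vector.∷ f)) → 2 ^ k ≤ total (suc k) g
coordinate-0-decides k g decides = begin
  2 ^ k                                                      ≡⟨ total-1 k ⟨
  total k (λ _ → 1)                                          ≤⟨ total-mono k decides ⟩
  total k (λ f → g (true Vector.∷ f) + g (false Vector.∷ f)) ≡⟨ total-+ k _ _ ⟩
  total (suc k) g                                            ∎
  where open ≤-Reasoning

-- Points with the same index have different bits and stay apart under every flip. For different
-- indices, changing the flip at one of them toggles whether the points are separated.
half-of-flips-separate : ∀ k {p q : Fin k × Bool} → p ≢ q →
  2 ^ k ≤ 2 * total k (separation p q)
half-of-flips-separate (suc k) {zero , x} {zero , y} p≢q =
  *-monoʳ-≤ 2 (coordinate-0-decides k (separation (zero , x) (zero , y)) λ _ → always x y (p≢q ∘ cong (zero ,_)))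
  where
  always : ∀ x y → x ≢ y → 1 ≤ ⟦ (x xor true) xor (y xor true) ⟧ + ⟦ (x xor false) xor (y xor false) ⟧
  always true  true  x≢y = contradiction refl x≢y
  always true  false x≢y = s≤s z≤n
  always false true  x≢y = s≤s z≤n
  always false false x≢y = contradiction refl x≢y
half-of-flips-separate (suc k) {zero , x} {suc j , y} p≢q =
  *-monoʳ-≤ 2 (coordinate-0-decides k (separation (zero , x) (suc j , y)) λ f → once x (y xor f j))
  where
  once : ∀ x z → 1 ≤ ⟦ (x xor true) xor z ⟧ + ⟦ (x xor false) xor z ⟧
  once true  true  = s≤s z≤n
  once true  false = s≤s z≤n
  once false true  = s≤s z≤n
  once false false = s≤s z≤n
half-of-flips-separate (suc k) {suc i , x} {zero , y} p≢q =
  *-monoʳ-≤ 2 (coordinate-0-decides k (separation (suc i , x) (zero , y)) λ f → once (x xor f i) y)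
  where
  once : ∀ z y → 1 ≤ ⟦ z xor (y xor true) ⟧ + ⟦ z xor (y xor false) ⟧
  once true  true  = s≤s z≤n
  once true  false = s≤s z≤n
  once false true  = s≤s z≤n
  once false false = s≤s z≤n
-- Coordinate 0 affects neither point, so both halves of the total equal the one for `k`.
half-of-flips-separate (suc k) {suc i , x} {suc j , y} p≢q = begin
  2 * 2 ^ k                         ≡⟨ double (2 ^ k) ⟩
  2 ^ k + 2 ^ k                     ≤⟨ +-mono-≤ ih ih ⟩
  2 * total k sep + 2 * total k sep ≡⟨ *-distribˡ-+ 2 (total k sep) (total k sep) ⟨
  2 * (total k sep + total k sep)   ∎
  where
  open ≤-Reasoning
  sep : (Fin k → Bool) → ℕ
  sep = separation (i , x) (j , y)
  ih : 2 ^ k ≤ 2 * total k sep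
  ih = half-of-flips-separate k {i , x} {j , y} λ { refl → p≢q refl }
  double : ∀ p → 2 * p ≡ p + p
  double = solve-∀

-- Vertices 2i and 2i + 1 share the index i, so that any choice of flips splits
-- the vertices into two parts of size at most ⌈ n /2⌉.
position : ∀ {n} → Fin n → Fin ⌈ n /2⌉ × Bool
position {suc zero}    zero          = zero , false
position {suc (suc n)} zero          = zero , false
position {suc (suc n)} (suc zero)    = zero , true
position {suc (suc n)} (suc (suc i)) = map₁ suc (position i)

position-injective : ∀ {n} (u v : Fin n) → position u ≡ position v → u ≡ v
position-injective {suc zero}    zero          zero          _  = refl
position-injective {suc (suc n)} zero          zero          _  = refl
position-injective {suc (suc n)} (suc zero)    (suc zero)    _  = refl
position-injective {suc (suc n)} (suc (suc u)) (suc (suc v)) eq =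
  cong (λ w → suc (suc w)) (position-injective u v
    (cong₂ _,_ (Fin.suc-injective (cong proj₁ eq)) (cong proj₂ eq)))
position-injective {suc (suc n)} zero          (suc zero)    ()
position-injective {suc (suc n)} (suc zero)    zero          ()
position-injective {suc (suc n)} zero          (suc (suc v)) ()
position-injective {suc (suc n)} (suc zero)    (suc (suc v)) ()
position-injective {suc (suc n)} (suc (suc u)) zero          ()
position-injective {suc (suc n)} (suc (suc u)) (suc zero)    ()

-- From a Ruzsa-Szemerédi graph to a triangle family.

module CrossingTriangles {n r t} {G : Graph n} (rs : RuzsaSzemerédi r t G) where
  open Graph G using (Adj; irrefl) renaming (sym to Adj-sym)
  open RuzsaSzemerédi rs
  open Tripartite ⌈ n /2⌉ t
  open Families ⌈ n /2⌉ t

  matching-unique : ∀ i → Unique (matching i)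
  matching-unique i = AllPairs.map (λ { d refl → d (here refl , here refl) })
    (InducedMatching.disjoint (isInduced i))

  common-end⇒≡ : ∀ {i x e e′} → e ∈ matching i → e′ ∈ matching i → x ∈ ends e → x ∈ ends e′ → e ≡ e′
  common-end⇒≡ {i} e∈ e′∈ x∈e x∈e′ with ∈-AllPairs₂ (InducedMatching.disjoint (isInduced i)) e∈ e′∈
  ... | inj₁ eq       = eq
  ... | inj₂ (inj₁ d) = ⊥-elim (d (x∈e , x∈e′))
  ... | inj₂ (inj₂ d) = ⊥-elim (d (x∈e′ , x∈e))

  partner-unique : ∀ {i u v w} → Joins (matching i) u v → Joins (matching i) u w → v ≡ w
  partner-unique (inj₁ p) (inj₁ q) = ,-injectiveʳ (common-end⇒≡ p q (here refl) (here refl))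
  partner-unique (inj₁ p) (inj₂ q) =
    let eq = common-end⇒≡ p q (here refl) (there (here refl)) in trans (,-injectiveʳ eq) (,-injectiveˡ eq)
  partner-unique (inj₂ p) (inj₁ q) =
    let eq = common-end⇒≡ p q (there (here refl)) (here refl) in trans (,-injectiveˡ eq) (,-injectiveʳ eq)
  partner-unique (inj₂ p) (inj₂ q) = ,-injectiveˡ (common-end⇒≡ p q (there (here refl)) (there (here refl)))

  Joins⇒covered : ∀ {i u v} → Joins (matching i) u v → u ∈ covered (matching i)
  Joins⇒covered (inj₁ e∈) = ∈-concatMap⁺ ends (lose e∈ (here refl))
  Joins⇒covered (inj₂ e∈) = ∈-concatMap⁺ ends (lose e∈ (there (here refl)))

  Joins⇒Adj : ∀ {i u v} → Joins (matching i) u v → Adj u v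
  Joins⇒Adj {i} (inj₁ e∈) = InducedMatching.edges (isInduced i) e∈
  Joins⇒Adj {i} (inj₂ e∈) = Adj-sym (InducedMatching.edges (isInduced i) e∈)

  -- The label remembers the matching of an edge and becomes the C-vertex of its triangle.
  labelled : Fin t → List (Fin t × Fin n × Fin n)
  labelled i = map (i ,_) (matching i)

  edges : List (Fin t × Fin n × Fin n)
  edges = concat (map labelled (allFin t))

  ∈-labelled⁻ : ∀ {i j e} → (j , e) ∈ labelled i → j ≡ i × e ∈ matching i
  ∈-labelled⁻ {i} x∈ with ∈-map⁻ (i ,_) x∈
  ... | _ , e∈ , refl = refl , e∈

  ∈-edges⁻ : ∀ {i e} → (i , e) ∈ edges → e ∈ matching i
  ∈-edges⁻ x∈ with find (Any.map⁻ (∈-concat⁻ (map labelled (allFin t)) x∈))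
  ... | i , _ , y∈ with ∈-labelled⁻ {i} y∈
  ...   | refl , e∈ = e∈

  ∈-edges⁺ : ∀ {i e} → e ∈ matching i → (i , e) ∈ edges
  ∈-edges⁺ {i} e∈ = ∈-concat⁺′ (∈-map⁺ (i ,_) e∈) (∈-map⁺ labelled (∈-allFin i))

  edges-unique : Unique edges
  edges-unique = Unique.concat⁺
    (All.map⁺ (All.tabulate λ {i} _ → Unique.map⁺ ,-injectiveʳ (matching-unique i)))
    (AllPairs.map⁺ (AllPairs.map labels-disjoint (Unique.allFin⁺ t)))
    where
    labels-disjoint : ∀ {i j} → i ≢ j → Disjoint (labelled i) (labelled j)
    labels-disjoint {i} {j} i≢j (x∈ , y∈) =
      i≢j (trans (sym (proj₁ (∈-labelled⁻ {i} x∈))) (proj₁ (∈-labelled⁻ {j} y∈)))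

  length-edges : length edges ≡ r * t
  length-edges = begin
    length edges                         ≡⟨ length-concat-const labelled-sizes ⟩
    length (map labelled (allFin t)) * r ≡⟨ cong (_* r) (length-map labelled (allFin t)) ⟩
    length (allFin t) * r                ≡⟨ cong (_* r) (length-tabulate {n = t} id) ⟩
    t * r                                ≡⟨ *-comm t r ⟩
    r * t                                ∎
    where
    open ≡-Reasoning
    labelled-sizes : All (λ xs → length xs ≡ r) (map labelled (allFin t))
    labelled-sizes = All.map⁺ {xs = allFin t}
      (All.tabulate λ {i} _ → trans (length-map (i ,_) (matching i)) (size i))

  module _ (f : Fin ⌈ n /2⌉ → Bool) where

    half : Fin n → Fin ⌈ n /2⌉
    half v = proj₁ (position v)

    side : Fin n → Bool
    side v = flip f (position v)

    -- For a known index the flip can be undone, so the side gives back the bit of the vertex. Hence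
    -- `half` is injective on each side, and the two sides embed into A and B.
    half-side-injective : ∀ {u v x} → side u ≡ x → side v ≡ x → half u ≡ half v → u ≡ v
    half-side-injective {u} {v} refl sv hu = position-injective u v
      (cong₂ _,_ hu (xor-cancelʳ (proj₂ (position u)) (proj₂ (position v)) (f (half v))
        (trans (cong (λ h → proj₂ (position u) xor f h) (sym hu)) (sym sv))))
      where
      xor-cancelʳ : ∀ x y z → x xor z ≡ y xor z → x ≡ y
      xor-cancelʳ true  true  _     _  = refl
      xor-cancelʳ false false _     _  = refl
      xor-cancelʳ true  false true  ()
      xor-cancelʳ true  false false ()
      xor-cancelʳ false true  true  ()
      xor-cancelʳ false true  false ()

    crosses : Fin t × Fin n × Fin n → Bool
    crosses (_ , u , v) = side u xor side v

    -- Side `false` goes to A and side `true` to B. On edges that do not cross the value is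
    -- meaningless; `family` filters them out first.
    triangle : Fin t × Fin n × Fin n → Triangle
    triangle (i , u , v) = if side u then (half v , half u , i) else (half u , half v , i)

    record Oriented (e : Fin n × Fin n) (a b : Fin ⌈ n /2⌉) : Set where
      constructor oriented
      field
        {lower upper} : Fin n
        same-edge     : e ≡ (lower , upper) ⊎ e ≡ (upper , lower)
        lower-side    : side lower ≡ false
        upper-side    : side upper ≡ true
        lower-half    : half lower ≡ a
        upper-half    : half upper ≡ b

    lower∈ends : ∀ {e a b} (o : Oriented e a b) → Oriented.lower o ∈ ends e
    lower∈ends (oriented (inj₁ refl) _ _ _ _) = here refl
    lower∈ends (oriented (inj₂ refl) _ _ _ _) = there (here refl)

    Oriented⇒Joins : ∀ {M e a b} (o : Oriented e a b) → e ∈ M → Joins M (Oriented.lower o) (Oriented.upper o)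
    Oriented⇒Joins (oriented (inj₁ refl) _ _ _ _) e∈ = inj₁ e∈
    Oriented⇒Joins (oriented (inj₂ refl) _ _ _ _) e∈ = inj₂ e∈

    orient : ∀ i u v {a b c} → T (crosses (i , u , v)) → triangle (i , u , v) ≡ (a , b , c) →
      c ≡ i × Oriented (u , v) a b
    orient i u v crossing refl with side u in su | side v in sv
    ... | true  | false = refl , oriented (inj₂ refl) sv su refl refl
    ... | false | true  = refl , oriented (inj₁ refl) su sv refl refl

    triangle-lower-upper : ∀ i {u v} → side u ≡ false → triangle (i , u , v) ≡ (half u , half v , i)
    triangle-lower-upper i su rewrite su = refl

    triangle-upper-lower : ∀ i {u v} → side u ≡ true → triangle (i , u , v) ≡ (half v , half u , i)
    triangle-upper-lower i su rewrite su = refl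

    crossingEdges : List (Fin t × Fin n × Fin n)
    crossingEdges = filterᵇ crosses edges

    family : List Triangle
    family = map triangle crossingEdges

    ∈-crossingEdges⁻ : ∀ {i u v} → (i , u , v) ∈ crossingEdges →
      (u , v) ∈ matching i × T (crosses (i , u , v))
    ∈-crossingEdges⁻ x∈ = map₁ ∈-edges⁻ (∈-filter⁻ (λ x → T? (crosses x)) {xs = edges} x∈)

    -- Membership in `family` with the listed orientation of the edge forgotten, so that the
    -- independence proofs need no case split on it.
    record Crossing (a b : Fin ⌈ n /2⌉) (i : Fin t) : Set where
      constructor crossing
      field
        {lower upper} : Fin n
        joins         : Joins (matching i) lower upper
        lower-side    : side lower ≡ false
        upper-side    : side upper ≡ true
        lower-half    : half lower ≡ a
        upper-half    : half upper ≡ b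

    ∈-family⁻ : ∀ {a b i} → (a , b , i) ∈ family → Crossing a b i
    ∈-family⁻ T∈ with ∈-map⁻ triangle T∈
    ... | (i , u , v) , x∈ , eq with ∈-crossingEdges⁻ x∈
    ...   | e∈ , c with orient i u v c (sym eq)
    ...     | refl , o@(oriented _ ls us lh uh) = crossing (Oriented⇒Joins o e∈) ls us lh uh

    ∈-family⁺ : ∀ {a b i} → Crossing a b i → (a , b , i) ∈ family
    ∈-family⁺ {i = i} (crossing {u} {v} (inj₁ e∈) su sv refl refl) =
      subst (_∈ family) (triangle-lower-upper i su)
        (∈-map⁺ triangle (∈-filter⁺ (λ x → T? (crosses x)) (∈-edges⁺ e∈)
          (subst T (sym (cong₂ _xor_ su sv)) _)))
    ∈-family⁺ {i = i} (crossing {u} {v} (inj₂ e∈) su sv refl refl) =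
      subst (_∈ family) (triangle-upper-lower i sv)
        (∈-map⁺ triangle (∈-filter⁺ (λ x → T? (crosses x)) (∈-edges⁺ e∈)
          (subst T (sym (cong₂ _xor_ sv su)) _)))

    lower-≡ : ∀ {a b b′ i j} (p : Crossing a b i) (q : Crossing a b′ j) → Crossing.lower p ≡ Crossing.lower q
    lower-≡ p q = half-side-injective (Crossing.lower-side p) (Crossing.lower-side q)
      (trans (Crossing.lower-half p) (sym (Crossing.lower-half q)))

    upper-≡ : ∀ {a a′ b i j} (p : Crossing a b i) (q : Crossing a′ b j) → Crossing.upper p ≡ Crossing.upper q
    upper-≡ p q = half-side-injective (Crossing.upper-side p) (Crossing.upper-side q)
      (trans (Crossing.upper-half p) (sym (Crossing.upper-half q)))

    crossing-a-unique : ∀ {a a′ b i} → Crossing a b i → Crossing a′ b i → a ≡ a′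
    crossing-a-unique p@(crossing ju _ _ refl _) q@(crossing jv _ _ refl _) with upper-≡ p q
    ... | refl = cong half (partner-unique (swap ju) (swap jv))

    crossing-b-unique : ∀ {a b b′ i} → Crossing a b i → Crossing a b′ i → b ≡ b′
    crossing-b-unique p@(crossing ju _ _ _ refl) q@(crossing jv _ _ _ refl) with lower-≡ p q
    ... | refl = cong half (partner-unique ju jv)

    crossing-c-unique : ∀ {a b i j} → Crossing a b i → Crossing a b j → i ≡ j
    crossing-c-unique p@(crossing ju _ _ _ _) q@(crossing jv _ _ _ _) with lower-≡ p q | upper-≡ p q
    ... | refl | refl = edgeDisjoint ju jv

    -- The edge of the first triangle joins the lower vertex of the second to the upper vertex of
    -- the third. Both are covered by matching `c`, which is induced and therefore contains that
    -- edge.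
    crossing-closed : ∀ {a b c a′ b′ c′} → Crossing a b c′ → Crossing a b′ c → Crossing a′ b c → Crossing a b c
    crossing-closed {c = c} p@(crossing ju ls us lh uh) q@(crossing jv _ _ _ _) s@(crossing jw _ _ _ _)
      with lower-≡ p q | upper-≡ p s
    ... | refl | refl = crossing
      (InducedMatching.induced (isInduced c) (Joins⇒covered jv) (Joins⇒covered (swap jw)) (Joins⇒Adj ju))
      ls us lh uh

    -- The C-vertex gives the matching and the A-vertex the lower endpoint; within a matching an
    -- endpoint determines the edge.
    triangle-injective : ∀ {x y} → x ∈ crossingEdges → y ∈ crossingEdges → triangle x ≡ triangle y → x ≡ y
    triangle-injective {i , u , v} {j , u′ , v′} x∈ y∈ eq
      with ∈-crossingEdges⁻ x∈ | ∈-crossingEdges⁻ y∈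
    ... | e∈ , c | e′∈ , c′ with orient i u v c eq | orient j u′ v′ c′ refl
    ...   | i≡ , o | j≡ , o′ with trans (sym i≡) j≡
    ...     | refl with half-side-injective (Oriented.lower-side o) (Oriented.lower-side o′)
                          (trans (Oriented.lower-half o) (sym (Oriented.lower-half o′)))
    ...       | lower≡ = cong (i ,_) (common-end⇒≡ e∈ e′∈ (lower∈ends o)
                           (subst (_∈ ends (u′ , v′)) (sym lower≡) (lower∈ends o′)))

    family-independent : Independent family
    family-independent = record
      { unique   = AllPairs.map⁺ (AllPairs-map∈ (λ x∈ y∈ x≢y eq → x≢y (triangle-injective x∈ y∈ eq))
                     (Unique.filter⁺ (λ x → T? (crosses x)) edges-unique))
      ; a-unique = λ p q → crossing-a-unique (∈-family⁻ p) (∈-family⁻ q)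
      ; b-unique = λ p q → crossing-b-unique (∈-family⁻ p) (∈-family⁻ q)
      ; c-unique = λ p q → crossing-c-unique (∈-family⁻ p) (∈-family⁻ q)
      ; closed   = λ p q s → ∈-family⁺ (crossing-closed (∈-family⁻ p) (∈-family⁻ q) (∈-family⁻ s))
      }

  halfCut : ∃ λ f → length edges ≤ 2 * length (crossingEdges f)
  halfCut = above-average ⌈ n /2⌉ (λ f → length (crossingEdges f))
    (total-filterᵇ ⌈ n /2⌉ crosses (All.tabulate λ { {i , u , v} x∈ →
      half-of-flips-separate ⌈ n /2⌉ λ eq → loopless (∈-edges⁻ x∈) (position-injective u v eq) }))
    where
    loopless : ∀ {i u v} → (u , v) ∈ matching i → u ≢ v
    loopless e∈ refl = irrefl (Joins⇒Adj (inj₁ e∈))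

ruzsaSzemerédi⇒α₃ : ∀ n r t → (∃ λ (G : Graph n) → RuzsaSzemerédi r t G) → r * t ≤ 2 * α₃ ⌈ n /2⌉ t
ruzsaSzemerédi⇒α₃ n r t (G , rs) with CrossingTriangles.halfCut rs
... | f , half≤ = begin
  r * t                            ≡⟨ length-edges ⟨
  length edges                     ≤⟨ half≤ ⟩
  2 * length (crossingEdges f)     ≡⟨ cong (2 *_) (length-map (triangle f) (crossingEdges f)) ⟨
  2 * length (family f)            ≤⟨ *-monoʳ-≤ 2 (Independent⇒length≤α₃ (family-independent f)) ⟩
  2 * α₃ ⌈ n /2⌉ t                 ∎
  where
  open CrossingTriangles rs
  open Families ⌈ n /2⌉ t
  open ≤-Reasoning

lemma17 : (∀ (n r t : ℕ) → (∃ λ (G : Graph n) → RuzsaSzemerédi r t G) →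
    r * t ≤ 2 * α₃ ⌈ n /2⌉ t)
    ×
    (∀ (n r t : ℕ) → r * t ≤ α₃ n t →
    ∃ λ (G : Graph (2 * n)) → RuzsaSzemerédi ⌈ r /2⌉ t G)
lemma17 = ruzsaSzemerédi⇒α₃ , α₃⇒ruzsaSzemerédi
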